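{- Let $G$ be a finite simple graph with $\gamma(G)=k$ and let $\overline{G}$ be its complement. Then: (i) if there exists a $k$-witness of $G$ that is both left-free and right-free, then $\gamma(\overline{G})=k-1$; (ii) otherwise, if there exists a $k$-witness of $G$ that is free, then $\gamma(\overline{G})\le k$; (iii) otherwise, if no $k$-witness of $G$ is free, then $\gamma(\overline{G})\le k+1$.
   Context: All graphs are finite, simple and undirected. A graph $G=(V,E)$ is a star-$k$-PCG if there exist a weight function $w:V\to\mathbb{R}^+$ and $k$ pairwise disjoint intervals $I_1,\dots,I_k$ such that for distinct $u,v\in V$, $uv\in E$ if and only if $w(u)+w(v)\in\bigcup_i I_i$; the weighted graph $G^w$ with these intervals is a $k$-witness. Intervals are $I_i=[a_i,b_i]$ with $b_i<a_{i+1}$. The star number $\gamma(G)$ is the least positive $k$ such that $G$ is a star-$k$-PCG. For distinct $u,v$, $w(uv)=w(u)+w(v)$. For $\gamma(G)=k$, a $k$-witness is left-free if every non-edge $e$ satisfies $w(e)>b_1$, right-free if every non-edge $e$ satisfies $w(e)<a_k$, and free if it is left-free or right-free.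
   Formalization: Part (i) is stated for k ≥ 2, since for k = 1 it fails (K₂ has γ = 1 and a left- and right-free witness, yet its complement has γ = 1, not 0); weights and interval endpoints are rational, which leaves γ and the existence of such witnesses unchanged. -}

module Defs where

open import Data.Nat using (ℕ; zero; suc)
open import Data.Fin using (Fin; zero; suc; fromℕ; _≟_; toℕ)
open import Data.Nat using () renaming (_≤_ to _≤ℕ_; _<_ to _<ℕ_)
open import Data.Sum using (_⊎_)
open import Data.Bool using (Bool; true; false; not)
open import Data.Rational using (ℚ; 0ℚ; _+_; _<_; _≤_)
open import Data.Product using (Σ; ∃; ∃-syntax; _×_)
open import Relation.Binary.PropositionalEquality using (_≡_; _≢_; refl; sym; cong)
open import Relation.Nullary using (¬_; yes; no)
open import Data.Empty using (⊥-elim)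
open import Function.Bundles using (_⇔_)

record Graph (n : ℕ) : Set where
  field
    Adj    : Fin n → Fin n → Bool
    Adj-sym    : ∀ u v → Adj u v ≡ Adj v u
    Adj-irrefl : ∀ u → Adj u u ≡ false
open Graph public

complAdj : ∀ {n} → Graph n → Fin n → Fin n → Bool
complAdj G u v with u ≟ v
... | yes _ = false
... | no  _ = not (Adj G u v)

private
  complAdj-sym : ∀ {n} (G : Graph n) u v → complAdj G u v ≡ complAdj G v u
  complAdj-sym G u v with u ≟ v | v ≟ u
  ... | yes _ | yes _ = refl
  ... | yes p | no ¬q = ⊥-elim (¬q (sym p))
  ... | no ¬p | yes q = ⊥-elim (¬p (sym q))
  ... | no _  | no _  = cong not (Adj-sym G u v)

  complAdj-irrefl : ∀ {n} (G : Graph n) u → complAdj G u u ≡ false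
  complAdj-irrefl G u with u ≟ u
  ... | yes _ = refl
  ... | no ¬p = ⊥-elim (¬p refl)

complement : ∀ {n} → Graph n → Graph n
complement G = record
  { Adj = complAdj G
  ; Adj-sym = complAdj-sym G
  ; Adj-irrefl = complAdj-irrefl G }

record Witness {n : ℕ} (G : Graph n) (k : ℕ) : Set where
  field
    w   : Fin n → ℚ
    a b : Fin k → ℚ
    w-pos     : ∀ u → 0ℚ < w u
    interval  : ∀ i → a i ≤ b i
    ordered   : ∀ (i j : Fin k) → toℕ j ≡ suc (toℕ i) → b i < a j
    edge-iff  : ∀ u v → u ≢ v →
                  (Adj G u v ≡ true) ⇔ (∃[ i ] (a i ≤ w u + w v × w u + w v ≤ b i))
open Witness public

StarPCG : ∀ {n} → Graph n → ℕ → Set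
StarPCG G k = Witness G k

StarNumber : ∀ {n} → Graph n → ℕ → Set
StarNumber G k = (1 ≤ℕ k) × StarPCG G k × (∀ j → 1 ≤ℕ j → j <ℕ k → ¬ StarPCG G j)

StarNumber≤ : ∀ {n} → Graph n → ℕ → Set
StarNumber≤ G k = ∃[ j ] (StarNumber G j × j ≤ℕ k)

-- Free-ness of a (suc m)-witness (I_1 = index zero, I_k = index fromℕ m).
-- A non-edge is a pair of distinct vertices that is not adjacent.
LeftFree : ∀ {n m} {G : Graph n} → Witness G (suc m) → Set
LeftFree {G = G} W = ∀ u v → u ≢ v → Adj G u v ≡ false → b W zero < w W u + w W v

RightFree : ∀ {n m} {G : Graph n} → Witness G (suc m) → Set
RightFree {m = m} {G = G} W = ∀ u v → u ≢ v → Adj G u v ≡ false → w W u + w W v < a W (fromℕ m)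

Free : ∀ {n m} {G : Graph n} → Witness G (suc m) → Set
Free W = LeftFree W ⊎ RightFree W

{-# OPTIONS --safe #-}

-- The gaps between the k intervals of a witness of G, closed up around the
-- finitely many edge weights, are k + 1 intervals for the complement with the
-- same vertex weights; left-freeness makes the first gap superfluous and
-- right-freeness the last one. Applied to the complement, the same
-- construction turns a j-witness of the complement into a (j+1)-witness of G,
-- which gives the minimality in (i).
--
-- Constructively, an upper bound on the star number requires finding the least
-- k that admits a witness. Witnesses are the solutions of a finite disjunction
-- of systems of linear inequalities over ℚ in the weights and the interval
-- endpoints, so their existence is decided by Fourier–Motzkin elimination.

module Submission where

open import Defs
open import Data.Bool using (Bool; true; false; not; _∨_)
open import Data.Bool.Properties using (not-involutive; ¬-not)
open import Data.Empty using (⊥; ⊥-elim)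
open import Data.Fin using (Fin; zero; suc; toℕ; fromℕ; inject₁; splitAt; _↑ˡ_; _↑ʳ_; _≟_)
open import Data.Fin.Properties using (splitAt-↑ˡ; splitAt-↑ʳ; toℕ-inject₁)
open import Data.Fin.Relation.Unary.Top using (View; view; ‵fromℕ; ‵inject₁)
open import Data.List using (List; []; _∷_; _++_; map; tabulate; allFin; cartesianProductWith)
open import Data.List.Membership.Propositional using (_∈_)
open import Data.List.Membership.Propositional.Properties using (∈-allFin; ∈-cartesianProductWith⁺)
open import Data.List.Relation.Unary.All as All using (All; []; _∷_)
open import Data.List.Relation.Unary.All.Properties as All using ()
open import Data.List.Relation.Unary.Any as Any using (Any; here; there)
open import Data.List.Relation.Unary.Any.Properties as Any using ()
open import Data.Nat using (ℕ; suc; _≤_)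
open import Data.Nat as ℕ using (zero; z≤n; s≤s)
open import Data.Nat.Properties as ℕ using ()
open import Data.Product using (Σ; ∃-syntax; _×_; _,_; proj₁; proj₂)
open import Data.Rational using (ℚ; 0ℚ; 1ℚ; _+_; _*_; -_; _-_; 1/_; _⊓_; _⊔_; Positive; positive; NonZero) renaming (_≤_ to _≤ℚ_; _<_ to _<ℚ_)
open import Data.Rational.Properties as ℚ using ()
open import Data.Rational.Solver using (module +-*-Solver)
open import Data.Sum as Sum using (_⊎_; inj₁; inj₂; [_,_])
open import Function using (_∘_; id)
open import Function.Bundles using (_⇔_; mk⇔; module Equivalence)
open import Function.Construct.Composition using (_⇔-∘_)
open import Function.Construct.Symmetry using (⇔-sym)
open import Relation.Binary.Definitions using (tri<; tri≈; tri>)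
open import Relation.Binary.PropositionalEquality using (_≡_; _≢_; refl; sym; trans; cong; cong₂; subst; subst₂)
open import Relation.Nullary using (¬_; Dec; yes; no)
open import Relation.Nullary.Decidable as Dec using (toWitness)

open Equivalence using (to; from)
open +-*-Solver using (solve; con; _:=_; _:+_; _:-_; _:*_; :-_)

-- Finite sets of rationals

<⇒≱ : ∀ {p q} → p <ℚ q → ¬ q ≤ℚ p
<⇒≱ p<q q≤p = ℚ.<-irrefl refl (ℚ.<-≤-trans p<q q≤p)

p-1<p : ∀ p → p - 1ℚ <ℚ p
p-1<p p = subst (p - 1ℚ <ℚ_) (ℚ.+-identityʳ p) (ℚ.+-monoʳ-< p (toWitness {a? = (- 1ℚ) ℚ.<? 0ℚ} _))

p<p+1 : ∀ p → p <ℚ p + 1ℚ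
p<p+1 p = subst (_<ℚ p + 1ℚ) (ℚ.+-identityʳ p) (ℚ.+-monoʳ-< p (toWitness {a? = 0ℚ ℚ.<? 1ℚ} _))

strictLowerBound : (xs : List ℚ) → ∃[ lo ] All (lo <ℚ_) xs
strictLowerBound []       = 0ℚ , []
strictLowerBound (x ∷ xs) with strictLowerBound xs
... | lo , lo<xs = lo ⊓ (x - 1ℚ)
                 , ℚ.≤-<-trans (ℚ.p⊓q≤q lo (x - 1ℚ)) (p-1<p x)
                 ∷ All.map (ℚ.≤-<-trans (ℚ.p⊓q≤p lo (x - 1ℚ))) lo<xs

strictUpperBound : (xs : List ℚ) → ∃[ hi ] All (_<ℚ hi) xs
strictUpperBound []       = 0ℚ , []
strictUpperBound (x ∷ xs) with strictUpperBound xs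
... | hi , xs<hi = hi ⊔ (x + 1ℚ)
                 , ℚ.<-≤-trans (p<p+1 x) (ℚ.p≤q⊔p hi (x + 1ℚ))
                 ∷ All.map (λ x<hi → ℚ.<-≤-trans x<hi (ℚ.p≤p⊔q hi (x + 1ℚ))) xs<hi

-- The gaps are open, while the intervals of a witness must be closed. Only finitely many edge
-- weights matter, so an open gap can be traded for a closed interval strictly inside it that loses
-- none of them.
shrink : ∀ {q r} → q <ℚ r → (S : List ℚ) →
         ∃[ x ] ∃[ y ] (q <ℚ x × x ≤ℚ y × y <ℚ r ×
                        All (λ s → q <ℚ s → s <ℚ r → x ≤ℚ s × s ≤ℚ y) S)
-- A point from density is the starting interval, to be widened by each element of `S` in the gap;
-- the result is therefore nonempty even if no element lies there.
shrink q<r [] with ℚ.<-dense q<r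
... | m , q<m , m<r = m , m , q<m , ℚ.≤-refl , m<r , []
shrink {q} {r} q<r (s ∷ S) with shrink q<r S | q ℚ.<? s | s ℚ.<? r
... | x , y , q<x , x≤y , y<r , h | no q≮s | _ =
  x , y , q<x , x≤y , y<r , (λ q<s _ → ⊥-elim (q≮s q<s)) ∷ h
... | x , y , q<x , x≤y , y<r , h | yes _ | no s≮r =
  x , y , q<x , x≤y , y<r , (λ _ s<r → ⊥-elim (s≮r s<r)) ∷ h
... | x , y , q<x , x≤y , y<r , h | yes q<s | yes s<r =
  x ⊓ s , y ⊔ s , q<x⊓s
  , ℚ.≤-trans (ℚ.p⊓q≤p x s) (ℚ.≤-trans x≤y (ℚ.p≤p⊔q y s))
  , y⊔s<r
  , (λ _ _ → ℚ.p⊓q≤q x s , ℚ.p≤q⊔p y s)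
  ∷ All.map (λ h q<t t<r → ℚ.≤-trans (ℚ.p⊓q≤p x s) (proj₁ (h q<t t<r))
                         , ℚ.≤-trans (proj₂ (h q<t t<r)) (ℚ.p≤p⊔q y s)) h
  where
  q<x⊓s : q <ℚ x ⊓ s
  q<x⊓s with ℚ.⊓-sel x s
  ... | inj₁ eq = subst (q <ℚ_) (sym eq) q<x
  ... | inj₂ eq = subst (q <ℚ_) (sym eq) q<s

  y⊔s<r : y ⊔ s <ℚ r
  y⊔s<r with ℚ.⊔-sel y s
  ... | inj₁ eq = subst (_<ℚ r) (sym eq) y<r
  ... | inj₂ eq = subst (_<ℚ r) (sym eq) s<r

-- Strict and non-strict inequalities

-- Strictness is a Boolean, so that chaining two inequalities combines it by `_∨_` and elimination
-- treats both kinds uniformly.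
Rel : Bool → ℚ → ℚ → Set
Rel true  = _<ℚ_
Rel false = _≤ℚ_

Rel? : ∀ s x y → Dec (Rel s x y)
Rel? true  = ℚ._<?_
Rel? false = ℚ._≤?_

<⇒Rel : ∀ s {x y} → x <ℚ y → Rel s x y
<⇒Rel true  = id
<⇒Rel false = ℚ.<⇒≤

Rel⇒≤ : ∀ s {x y} → Rel s x y → x ≤ℚ y
Rel⇒≤ true  = ℚ.<⇒≤
Rel⇒≤ false = id

Rel-trans : ∀ s t {x y z} → Rel s x y → Rel t y z → Rel (s ∨ t) x z
Rel-trans true  t     x<y yz  = ℚ.<-≤-trans x<y (Rel⇒≤ t yz)
Rel-trans false true  x≤y y<z = ℚ.≤-<-trans x≤y y<z
Rel-trans false false         = ℚ.≤-trans

-- The converse of `Rel-trans`, and the point where elimination uses that ℚ is dense: a strict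
-- inequality leaves room for a point in between, and otherwise `x` itself serves.
Rel-interpolate : ∀ s t {x z} → Rel (s ∨ t) x z → ∃[ y ] (Rel s x y × Rel t y z)
Rel-interpolate false false x≤z = _ , ℚ.≤-refl , x≤z
Rel-interpolate true  t     x<z with ℚ.<-dense x<z
... | y , x<y , y<z = y , x<y , <⇒Rel t y<z
Rel-interpolate false true  x<z with ℚ.<-dense x<z
... | y , x<y , y<z = y , ℚ.<⇒≤ x<y , y<z

Rel-+ : ∀ s t {x y} → Rel s x y → Rel s (x + t) (y + t)
Rel-+ true  t = ℚ.+-monoˡ-< t
Rel-+ false t = ℚ.+-monoˡ-≤ t

Rel-* : ∀ s r .{{_ : Positive r}} {x y} → Rel s x y → Rel s (x * r) (y * r)
Rel-* true  r = ℚ.*-monoˡ-<-pos r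
Rel-* false r = ℚ.*-monoʳ-≤-nonNeg r {{ℚ.pos⇒nonNeg r}}

-- Lower and upper bounds on one unknown

Bound : Set
Bound = Bool × ℚ

_⋖_ : Bound → ℚ → Set
(s , l) ⋖ x = Rel s l x

_⋗_ : Bound → ℚ → Set
(s , u) ⋗ x = Rel s x u

-- What remains of a lower and an upper bound once the unknown between them is eliminated.
Compatible : Bound → Bound → Set
Compatible (s , l) (t , u) = Rel (s ∨ t) l u

-- The larger endpoint gives the stronger bound; at equal endpoints a strict bound implies either
-- kind, and either kind implies the non-strict one.
⋖-total : ∀ l m → (∀ x → l ⋖ x → m ⋖ x) ⊎ (∀ x → m ⋖ x → l ⋖ x)
⋖-total (s , l) (t , m) with ℚ.<-cmp l m
⋖-total (s , l) (t , m) | tri< l<m _ _ = inj₂ λ x m⋖x → <⇒Rel s (ℚ.<-≤-trans l<m (Rel⇒≤ t m⋖x))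
⋖-total (s , l) (t , m) | tri> _ _ m<l = inj₁ λ x l⋖x → <⇒Rel t (ℚ.<-≤-trans m<l (Rel⇒≤ s l⋖x))
⋖-total (true  , l) (t , .l) | tri≈ _ refl _ = inj₁ λ x → <⇒Rel t
⋖-total (false , l) (t , .l) | tri≈ _ refl _ = inj₂ λ x → Rel⇒≤ t

⋗-total : ∀ l m → (∀ x → l ⋗ x → m ⋗ x) ⊎ (∀ x → m ⋗ x → l ⋗ x)
⋗-total (s , l) (t , m) with ℚ.<-cmp l m
⋗-total (s , l) (t , m) | tri< l<m _ _ = inj₁ λ x l⋗x → <⇒Rel t (ℚ.≤-<-trans (Rel⇒≤ s l⋗x) l<m)
⋗-total (s , l) (t , m) | tri> _ _ m<l = inj₂ λ x m⋗x → <⇒Rel s (ℚ.≤-<-trans (Rel⇒≤ t m⋗x) m<l)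
⋗-total (true  , l) (t , .l) | tri≈ _ refl _ = inj₁ λ x → <⇒Rel t
⋗-total (false , l) (t , .l) | tri≈ _ refl _ = inj₂ λ x → Rel⇒≤ t

-- The relation is abstract so that one selection argument serves lower bounds and upper bounds
-- alike.
tightest : ∀ {_≺_ : Bound → ℚ → Set} →
           (∀ l m → (∀ x → l ≺ x → m ≺ x) ⊎ (∀ x → m ≺ x → l ≺ x)) →
           ∀ l ls → ∃[ m ] (m ∈ l ∷ ls × ∀ x → m ≺ x → All (_≺ x) (l ∷ ls))
tightest total l [] = l , here refl , λ x l≺x → l≺x ∷ []
tightest total l (l′ ∷ ls) with tightest total l′ ls
... | m , m∈ , m-tight with total l m
...   | inj₁ l⇒m = l , here refl , λ x l≺x → l≺x ∷ m-tight x (l⇒m x l≺x)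
...   | inj₂ m⇒l = m , there m∈ , λ x m≺x → m⇒l x m≺x ∷ m-tight x m≺x

-- One step of Fourier-Motzkin elimination. A point between the tightest lower and the tightest
-- upper bound satisfies all of them; if one side is empty, a point beyond all bounds of the other
-- side works.
bounds-solvable : ∀ ls us → All (λ l → All (Compatible l) us) ls ⇔
                            (∃[ x ] (All (_⋖ x) ls × All (_⋗ x) us))
bounds-solvable ls us = mk⇔ (solution ls us) compatible
  where
  solution : ∀ ls us → All (λ l → All (Compatible l) us) ls → ∃[ x ] (All (_⋖ x) ls × All (_⋗ x) us)
  solution [] us _ with strictLowerBound (map proj₂ us)
  ... | x , x<us = x , [] , All.map (λ {u} → <⇒Rel (proj₁ u)) (All.map⁻ x<us)
  solution ls@(_ ∷ _) [] _ with strictUpperBound (map proj₂ ls)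
  ... | x , ls<x = x , All.map (λ {l} → <⇒Rel (proj₁ l)) (All.map⁻ ls<x) , []
  solution (l ∷ ls) (u ∷ us) c with tightest ⋖-total l ls | tightest ⋗-total u us
  ... | (s , _) , l∈ , l-tight | (t , _) , u∈ , u-tight
    with Rel-interpolate s t (All.lookup (All.lookup c l∈) u∈)
  ... | x , l⋖x , x⋖u = x , l-tight x l⋖x , u-tight x x⋖u

  compatible : ∃[ x ] (All (_⋖ x) ls × All (_⋗ x) us) → All (λ l → All (Compatible l) us) ls
  compatible (x , ls⋖x , us⋗x) =
    All.map (λ {l} l⋖x → All.map (λ {u} u⋗x → Rel-trans (proj₁ l) (proj₁ u) l⋖x u⋗x) us⋗x) ls⋖x

-- Affine forms and Fourier–Motzkin elimination

Env : ℕ → Set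
Env N = Fin N → ℚ

extend : ∀ {N} → ℚ → Env N → Env (suc N)
extend x ρ zero    = x
extend x ρ (suc i) = ρ i

-- The coefficients of the variables in order, with the constant term last.
Affine : ℕ → Set
Affine zero    = ℚ
Affine (suc N) = ℚ × Affine N

eval : ∀ {N} → Affine N → Env N → ℚ
eval {zero}  c       ρ = c
eval {suc N} (c , f) ρ = c * ρ zero + eval f (ρ ∘ suc)

const : ∀ {N} → ℚ → Affine N
const {zero}  q = q
const {suc N} q = 0ℚ , const q

var : ∀ {N} → Fin N → Affine N
var zero    = 1ℚ , const 0ℚ
var (suc i) = 0ℚ , var i

_⊕_ : ∀ {N} → Affine N → Affine N → Affine N
_⊕_ {zero}  p       q       = p + q
_⊕_ {suc N} (c , f) (d , g) = c + d , f ⊕ g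

_⊛_ : ∀ {N} → ℚ → Affine N → Affine N
_⊛_ {zero}  r p       = r * p
_⊛_ {suc N} r (c , f) = r * c , r ⊛ f

eval-const : ∀ {N} q (ρ : Env N) → eval {N} (const q) ρ ≡ q
eval-const {zero}  q ρ = refl
eval-const {suc N} q ρ rewrite eval-const q (ρ ∘ suc) =
  solve 2 (λ x q → con 0ℚ :* x :+ q := q) refl (ρ zero) q

eval-var : ∀ {N} i (ρ : Env N) → eval (var i) ρ ≡ ρ i
eval-var {suc N} zero ρ rewrite eval-const 0ℚ (ρ ∘ suc) =
  solve 1 (λ x → con 1ℚ :* x :+ con 0ℚ := x) refl (ρ zero)
eval-var (suc i) ρ rewrite eval-var i (ρ ∘ suc) =
  solve 2 (λ x y → con 0ℚ :* x :+ y := y) refl (ρ zero) (ρ (suc i))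

eval-⊕ : ∀ {N} (f g : Affine N) ρ → eval (f ⊕ g) ρ ≡ eval f ρ + eval g ρ
eval-⊕ {zero}  p       q       ρ = refl
eval-⊕ {suc N} (c , f) (d , g) ρ rewrite eval-⊕ f g (ρ ∘ suc) =
  solve 5 (λ c d x p q → (c :+ d) :* x :+ (p :+ q) := (c :* x :+ p) :+ (d :* x :+ q)) refl
    c d (ρ zero) (eval f (ρ ∘ suc)) (eval g (ρ ∘ suc))

eval-⊛ : ∀ {N} r (f : Affine N) ρ → eval (r ⊛ f) ρ ≡ r * eval f ρ
eval-⊛ {zero}  r p       ρ = refl
eval-⊛ {suc N} r (c , f) ρ rewrite eval-⊛ r f (ρ ∘ suc) =
  solve 4 (λ r c x p → (r :* c) :* x :+ r :* p := r :* (c :* x :+ p)) refl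
    r c (ρ zero) (eval f (ρ ∘ suc))

_⊖_ : ∀ {N} → Affine N → Affine N → Affine N
f ⊖ g = f ⊕ ((- 1ℚ) ⊛ g)

eval-⊛-⊖ : ∀ {N} r (f g : Affine N) ρ → eval (r ⊛ (f ⊖ g)) ρ ≡ (eval f ρ - eval g ρ) * r
eval-⊛-⊖ r f g ρ rewrite eval-⊛ r (f ⊖ g) ρ | eval-⊕ f ((- 1ℚ) ⊛ g) ρ | eval-⊛ (- 1ℚ) g ρ =
  solve 3 (λ p q r → r :* (p :+ (:- con 1ℚ) :* q) := (p :- q) :* r) refl (eval f ρ) (eval g ρ) r

Constraint : ℕ → Set
Constraint N = Bool × Affine N × Affine N

Holds : ∀ {N} → Env N → Constraint N → Set
Holds ρ (s , f , g) = Rel s (eval f ρ) (eval g ρ)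

AffineBound : ℕ → Set
AffineBound N = Bool × Affine N

evalBound : ∀ {N} → Env N → AffineBound N → Bound
evalBound ρ (s , f) = s , eval f ρ

data Solved {N} (c : Constraint (suc N)) : Set where
  free  : (d : Constraint N)    → (∀ ρ → Holds ρ c ⇔ Holds (ρ ∘ suc) d) → Solved c
  lower : (l : AffineBound N) → (∀ ρ → Holds ρ c ⇔ (evalBound (ρ ∘ suc) l ⋖ ρ zero)) → Solved c
  upper : (u : AffineBound N) → (∀ ρ → Holds ρ c ⇔ (evalBound (ρ ∘ suc) u ⋗ ρ zero)) → Solved c

p<q⇒0<q-p : ∀ {p q} → p <ℚ q → 0ℚ <ℚ q - p
p<q⇒0<q-p {p} {q} p<q = subst (_<ℚ q - p) (ℚ.+-inverseʳ p) (ℚ.+-monoˡ-< (- p) p<q)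

Rel-cancel-+ : ∀ s t {x y} → Rel s (x + t) (y + t) → Rel s x y
Rel-cancel-+ s t {x} {y} h = subst₂ (Rel s) (lemma x) (lemma y) (Rel-+ s (- t) h)
  where
  lemma : ∀ x → x + t + - t ≡ x
  lemma x = solve 2 (λ x t → x :+ t :+ :- t := x) refl x t

Rel-shift : ∀ s {x y x′ y′} t → x + t ≡ x′ → y + t ≡ y′ → Rel s x y ⇔ Rel s x′ y′
Rel-shift s t refl refl = mk⇔ (Rel-+ s t) (Rel-cancel-+ s t)

-- Multiplying by the positive inverse `r′` undoes the scaling, which gives the reverse implication.
Rel-scale : ∀ s {x y} r r′ .{{_ : Positive r}} .{{_ : Positive r′}} → r * r′ ≡ 1ℚ →
            Rel s x y ⇔ Rel s (x * r) (y * r)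
Rel-scale s {x} {y} r r′ rr′≡1 =
  mk⇔ (Rel-* s r) (λ h → subst₂ (Rel s) (lemma x) (lemma y) (Rel-* s r′ h))
  where
  lemma : ∀ x → x * r * r′ ≡ x
  lemma x = trans (ℚ.*-assoc x r r′) (trans (cong (x *_) rr′≡1) (ℚ.*-identityʳ x))

p*x*1/p≡x : ∀ p .{{_ : NonZero p}} x → p * x * 1/ p ≡ x
p*x*1/p≡x p x = trans (solve 3 (λ p x r → p :* x :* r := (r :* p) :* x) refl p x (1/ p))
                      (trans (cong (_* x) (ℚ.*-inverseˡ p)) (ℚ.*-identityˡ x))

-- The order of the two leading coefficients decides the shape. If they agree, the variable cancels;
-- otherwise the smaller one is moved across, and dividing by the positive difference keeps the
-- direction of the inequality.
solveFor : ∀ {N} (c : Constraint (suc N)) → Solved c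
solveFor (s , (c , f) , (d , g)) with ℚ.<-cmp c d
... | tri≈ _ refl _ = free (s , f , g) λ ρ →
  Rel-shift s (- (c * ρ zero)) (eq (ρ zero) (eval f (ρ ∘ suc))) (eq (ρ zero) (eval g (ρ ∘ suc)))
  where
  eq : ∀ x p → c * x + p + - (c * x) ≡ p
  eq = solve 3 (λ c x p → c :* x :+ p :+ :- (c :* x) := p) refl c
... | tri< c<d _ _ = lower (s , r ⊛ (f ⊖ g)) λ ρ →
  subst₂ (λ l x → Holds ρ (s , (c , f) , (d , g)) ⇔ Rel s l x)
    (sym (eval-⊛-⊖ r f g (ρ ∘ suc))) (p*x*1/p≡x (d - c) (ρ zero))
    (Rel-scale s r (d - c) (ℚ.*-inverseˡ (d - c)) ⇔-∘
     Rel-shift s (- (c * ρ zero + eval g (ρ ∘ suc)))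
       (solve 4 (λ c x p q → c :* x :+ p :+ :- (c :* x :+ q) := p :- q) refl
          c (ρ zero) (eval f (ρ ∘ suc)) (eval g (ρ ∘ suc)))
       (solve 4 (λ c d x q → d :* x :+ q :+ :- (c :* x :+ q) := (d :- c) :* x) refl
          c d (ρ zero) (eval g (ρ ∘ suc))))
  where
  instance
    d-c-pos = positive (p<q⇒0<q-p c<d)
    d-c-nonZero = ℚ.pos⇒nonZero (d - c)
    r-pos = ℚ.1/pos⇒pos (d - c)
  r = 1/ (d - c)
... | tri> _ _ d<c = upper (s , r ⊛ (g ⊖ f)) λ ρ →
  subst₂ (λ x u → Holds ρ (s , (c , f) , (d , g)) ⇔ Rel s x u)
    (p*x*1/p≡x (c - d) (ρ zero)) (sym (eval-⊛-⊖ r g f (ρ ∘ suc)))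
    (Rel-scale s r (c - d) (ℚ.*-inverseˡ (c - d)) ⇔-∘
     Rel-shift s (- (d * ρ zero + eval f (ρ ∘ suc)))
       (solve 4 (λ c d x p → c :* x :+ p :+ :- (d :* x :+ p) := (c :- d) :* x) refl
          c d (ρ zero) (eval f (ρ ∘ suc)))
       (solve 4 (λ d x p q → d :* x :+ q :+ :- (d :* x :+ p) := q :- p) refl
          d (ρ zero) (eval f (ρ ∘ suc)) (eval g (ρ ∘ suc))))
  where
  instance
    c-d-pos = positive (p<q⇒0<q-p d<c)
    c-d-nonZero = ℚ.pos⇒nonZero (c - d)
    r-pos = ℚ.1/pos⇒pos (c - d)
  r = 1/ (c - d)

record Split {N} (cs : List (Constraint (suc N))) : Set where
  field
    frees  : List (Constraint N)
    lowers : List (AffineBound N)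
    uppers : List (AffineBound N)
    split-iff : ∀ ρ → All (Holds ρ) cs ⇔
                  (All (Holds (ρ ∘ suc)) frees
                   × All (λ l → evalBound (ρ ∘ suc) l ⋖ ρ zero) lowers
                   × All (λ u → evalBound (ρ ∘ suc) u ⋗ ρ zero) uppers)

split : ∀ {N} (cs : List (Constraint (suc N))) → Split cs
split [] = record
  { frees = [] ; lowers = [] ; uppers = []
  ; split-iff = λ ρ → mk⇔ (λ _ → [] , [] , []) (λ _ → []) }
split (c ∷ cs) with solveFor c | split cs
... | free d c⇔d | σ = record
  { Split σ
  ; frees = d ∷ Split.frees σ
  ; split-iff = λ ρ → mk⇔
      (λ { (h ∷ hs) → let fs , ls , us = to (Split.split-iff σ ρ) hs in to (c⇔d ρ) h ∷ fs , ls , us })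
      (λ { (f ∷ fs , ls , us) → from (c⇔d ρ) f ∷ from (Split.split-iff σ ρ) (fs , ls , us) }) }
... | lower l c⇔l | σ = record
  { Split σ
  ; lowers = l ∷ Split.lowers σ
  ; split-iff = λ ρ → mk⇔
      (λ { (h ∷ hs) → let fs , ls , us = to (Split.split-iff σ ρ) hs in fs , to (c⇔l ρ) h ∷ ls , us })
      (λ { (fs , l ∷ ls , us) → from (c⇔l ρ) l ∷ from (Split.split-iff σ ρ) (fs , ls , us) }) }
... | upper u c⇔u | σ = record
  { Split σ
  ; uppers = u ∷ Split.uppers σ
  ; split-iff = λ ρ → mk⇔
      (λ { (h ∷ hs) → let fs , ls , us = to (Split.split-iff σ ρ) hs in fs , ls , to (c⇔u ρ) h ∷ us })
      (λ { (fs , ls , u ∷ us) → from (c⇔u ρ) u ∷ from (Split.split-iff σ ρ) (fs , ls , us) }) }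

-- Semilinear predicates

-- Disjunctive normal form: the outer list is a disjunction, each inner list a conjunction of linear
-- constraints.
Semilinear : ∀ {N} → (Env N → Set) → Set
Semilinear {N} P = Σ (List (List (Constraint N))) λ D → ∀ ρ → P ρ ⇔ Any (All (Holds ρ)) D

module _ {N : ℕ} where

  resp-⇔ : {P Q : Env N → Set} → (∀ ρ → P ρ ⇔ Q ρ) → Semilinear P → Semilinear Q
  resp-⇔ P⇔Q (D , P⇔D) = D , λ ρ → P⇔D ρ ⇔-∘ ⇔-sym (P⇔Q ρ)

  holds-semilinear : ∀ c → Semilinear {N} (λ ρ → Holds ρ c)
  holds-semilinear c = (c ∷ []) ∷ [] , λ ρ → mk⇔ (λ h → here (h ∷ [])) (λ { (here (h ∷ [])) → h })

  ⊤-semilinear : {P : Env N → Set} → (∀ ρ → P ρ) → Semilinear P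
  ⊤-semilinear p = [] ∷ [] , λ ρ → mk⇔ (λ _ → here []) (λ _ → p ρ)

  ⊥-semilinear : {P : Env N → Set} → (∀ ρ → ¬ P ρ) → Semilinear P
  ⊥-semilinear ¬p = [] , λ ρ → mk⇔ (⊥-elim ∘ ¬p ρ) (λ ())

  ⊎-semilinear : {P Q : Env N → Set} → Semilinear P → Semilinear Q → Semilinear (λ ρ → P ρ ⊎ Q ρ)
  ⊎-semilinear (D , P⇔D) (E , Q⇔E) = D ++ E , λ ρ → mk⇔
    [ Any.++⁺ˡ ∘ to (P⇔D ρ) , Any.++⁺ʳ D ∘ to (Q⇔E ρ) ]
    (Sum.map (from (P⇔D ρ)) (from (Q⇔E ρ)) ∘ Any.++⁻ D)

  -- Conjunction distributes over the disjunctions, so every disjunct of one is joined with every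
  -- disjunct of the other.
  ×-semilinear : {P Q : Env N → Set} → Semilinear P → Semilinear Q → Semilinear (λ ρ → P ρ × Q ρ)
  ×-semilinear (D , P⇔D) (E , Q⇔E) = cartesianProductWith _++_ D E , λ ρ → mk⇔
    (λ (p , q) → Any.cartesianProductWith⁺ _++_ All.++⁺ (to (P⇔D ρ) p) (to (Q⇔E ρ) q))
    (λ h → let p , q = Any.cartesianProductWith⁻ _++_ (All.++⁻ _) D E h
           in from (P⇔D ρ) p , from (Q⇔E ρ) q)

  →-semilinear : {A : Set} {P : Env N → Set} → Dec A → (A → Semilinear P) → Semilinear (λ ρ → A → P ρ)
  →-semilinear (yes a) P-sl = resp-⇔ (λ ρ → mk⇔ (λ p _ → p) (λ f → f a)) (P-sl a)
  →-semilinear (no ¬a) P-sl = ⊤-semilinear (λ ρ a → ⊥-elim (¬a a))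

  module _ {A : Set} {P : A → Env N → Set} (P-sl : ∀ x → Semilinear (P x)) where

    Any-semilinear : ∀ xs → Semilinear (λ ρ → Any (λ x → P x ρ) xs)
    Any-semilinear []       = ⊥-semilinear λ ρ ()
    Any-semilinear (x ∷ xs) = resp-⇔ (λ ρ → mk⇔ Any.fromSum Any.toSum)
                                     (⊎-semilinear (P-sl x) (Any-semilinear xs))

    All-semilinear : ∀ xs → Semilinear (λ ρ → All (λ x → P x ρ) xs)
    All-semilinear []       = ⊤-semilinear λ ρ → []
    All-semilinear (x ∷ xs) = resp-⇔ (λ ρ → mk⇔ (λ (p , ps) → p ∷ ps) All.uncons)
                                     (×-semilinear (P-sl x) (All-semilinear xs))

  module _ {n : ℕ} {P : Fin n → Env N → Set} (P-sl : ∀ i → Semilinear (P i)) where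

    ∀-semilinear : Semilinear (λ ρ → ∀ i → P i ρ)
    ∀-semilinear = resp-⇔ (λ ρ → mk⇔ (λ h i → All.lookup h (∈-allFin i)) (λ h → All.universal h (allFin n)))
                          (All-semilinear P-sl (allFin n))

    ∃Fin-semilinear : Semilinear (λ ρ → ∃[ i ] P i ρ)
    ∃Fin-semilinear = resp-⇔ (λ ρ → mk⇔ Any.satisfied (λ (i , p) → Any.map (λ { refl → p }) (∈-allFin i)))
                             (Any-semilinear P-sl (allFin n))

  -- The quantifier passes through the finite disjunction. Within one conjunction, the constraints
  -- free of the variable survive and every lower bound is paired with every upper bound.
  ∃-semilinear : {P : Env (suc N) → Set} → Semilinear P → Semilinear (λ ρ → ∃[ x ] P (extend x ρ))
  ∃-semilinear (D , P⇔D) = resp-⇔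
    (λ ρ → mk⇔ (λ h → let x , h′ = exchange D h in x , from (P⇔D (extend x ρ)) h′)
               (λ (x , p) → Any.map (x ,_) (to (P⇔D (extend x ρ)) p)))
    (Any-semilinear eliminate D)
    where
    exchange : ∀ {ρ} D → Any (λ cs → ∃[ x ] All (Holds (extend x ρ)) cs) D →
               ∃[ x ] Any (All (Holds (extend x ρ))) D
    exchange (_ ∷ _) (here (x , h)) = x , here h
    exchange (_ ∷ D) (there h)      = let x , h′ = exchange D h in x , there h′

    eliminate : (cs : List (Constraint (suc N))) → Semilinear (λ ρ → ∃[ x ] All (Holds (extend x ρ)) cs)
    eliminate cs = resp-⇔
      (λ ρ → mk⇔
        (λ (fs , c) →
          let x , ls , us = to (bounds-solvable (map (evalBound ρ) lowers) (map (evalBound ρ) uppers))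
                               (All.map⁺ (All.map All.map⁺ c))
          in x , from (split-iff (extend x ρ)) (fs , All.map⁻ ls , All.map⁻ us))
        (λ (x , h) →
          let fs , ls , us = to (split-iff (extend x ρ)) h
          in fs , All.map All.map⁻ (All.map⁻
               (from (bounds-solvable (map (evalBound ρ) lowers) (map (evalBound ρ) uppers))
                     (x , All.map⁺ ls , All.map⁺ us)))))
      (×-semilinear (All-semilinear holds-semilinear frees)
        (All-semilinear (λ (s , l) → All-semilinear (λ (t , u) → holds-semilinear (s ∨ t , l , u)) uppers) lowers))
      where open Split (split cs)

-- Eliminating the variables one at a time ends with inequalities between rational constants, which
-- are decidable.
∃-env? : ∀ {N} {P : Env N → Set} → Semilinear P → Dec (∃[ ρ ] P ρ)
∃-env? P-sl = Dec.map′ (λ (ρ , h) → ρ , from (proj₂ P-sl ρ) h) (λ (ρ , p) → ρ , to (proj₂ P-sl ρ) p)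
                       (satisfiable? (proj₁ P-sl))
  where
  satisfiable? : ∀ {N} (D : List (List (Constraint N))) → Dec (∃[ ρ ] Any (All (Holds ρ)) D)
  satisfiable? {zero} D = Dec.map′ ((λ ()) ,_) (λ (ρ , h) → Any.map (All.map id) h)
    (Any.any? (All.all? (λ (s , p , q) → Rel? s p q)) D)
  satisfiable? {suc N} D with ∃-semilinear {P = λ ρ → Any (All (Holds ρ)) D} (D , λ ρ → mk⇔ id id)
  ... | E , P⇔E = Dec.map′
    (λ (ρ , h) → let x , h′ = from (P⇔E ρ) h in extend x ρ , h′)
    -- `extend (ρ zero) (ρ ∘ suc)` agrees with `ρ` pointwise, and each constraint unfolds to the
    -- same inequality under both, so `id` carries it over.
    (λ (ρ , h) → ρ ∘ suc , to (P⇔E (ρ ∘ suc)) (ρ zero , Any.map (All.map id) h))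
    (satisfiable? E)

-- Deciding whether a graph is a star-k-PCG

IsWitness : ∀ {n k} → Graph n → (Fin n → ℚ) → (Fin k → ℚ) → (Fin k → ℚ) → Set
IsWitness G w a b =
  (∀ u → 0ℚ <ℚ w u) × (∀ i → a i ≤ℚ b i) × (∀ i j → toℕ j ≡ suc (toℕ i) → b i <ℚ a j) ×
  (∀ u v → u ≢ v → (Adj G u v ≡ true) ⇔ (∃[ i ] (a i ≤ℚ w u + w v × w u + w v ≤ℚ b i)))

-- A witness packed into an environment and read back agrees with the original only pointwise.
IsWitness-cong : ∀ {n k} (G : Graph n) {w w′ : Fin n → ℚ} {a a′ b b′ : Fin k → ℚ} →
                 (∀ u → w u ≡ w′ u) → (∀ i → a i ≡ a′ i) → (∀ i → b i ≡ b′ i) →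
                 IsWitness G w a b → IsWitness G w′ a′ b′
IsWitness-cong G w≡ a≡ b≡ (pos , int , ord , edge) =
    (λ u → subst (0ℚ <ℚ_) (w≡ u) (pos u))
  , (λ i → subst₂ _≤ℚ_ (a≡ i) (b≡ i) (int i))
  , (λ i j eq → subst₂ _<ℚ_ (b≡ i) (a≡ j) (ord i j eq))
  , (λ u v u≢v → mk⇔
      (λ h → let i , p , q = to (edge u v u≢v) h
             in i , subst₂ _≤ℚ_ (a≡ i) (sum≡ u v) p , subst₂ _≤ℚ_ (sum≡ u v) (b≡ i) q)
      (λ (i , p , q) → from (edge u v u≢v)
             (i , subst₂ _≤ℚ_ (sym (a≡ i)) (sym (sum≡ u v)) p , subst₂ _≤ℚ_ (sym (sum≡ u v)) (sym (b≡ i)) q)))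
  where
  sum≡ = λ u v → cong₂ _+_ (w≡ u) (w≡ v)

Rel-semilinear : ∀ {N} s {f g : Env N → ℚ} (F G : Affine N) →
                 (∀ ρ → eval F ρ ≡ f ρ) → (∀ ρ → eval G ρ ≡ g ρ) → Semilinear (λ ρ → Rel s (f ρ) (g ρ))
Rel-semilinear s F G f≡ g≡ =
  resp-⇔ (λ ρ → mk⇔ (subst₂ (Rel s) (f≡ ρ) (g≡ ρ)) (subst₂ (Rel s) (sym (f≡ ρ)) (sym (g≡ ρ))))
         (holds-semilinear (s , F , G))

-- For a fixed Boolean the equivalence is either `P` or its negation, so a normal form of each is
-- supplied.
≡true-⇔-semilinear : ∀ {N} c {P : Env N → Set} → Semilinear P → Semilinear (λ ρ → ¬ P ρ) →
                     Semilinear (λ ρ → (c ≡ true) ⇔ P ρ)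
≡true-⇔-semilinear true  P-sl ¬P-sl = resp-⇔ (λ ρ → mk⇔ (λ p → mk⇔ (λ _ → p) (λ _ → refl)) (λ h → to h refl)) P-sl
≡true-⇔-semilinear false P-sl ¬P-sl =
  resp-⇔ (λ ρ → mk⇔ (λ ¬p → mk⇔ (λ ()) (⊥-elim ∘ ¬p)) (λ h p → false≢true (from h p))) ¬P-sl
  where
  false≢true : false ≢ true
  false≢true ()

module _ {n k : ℕ} (G : Graph n) where

  private
    -- The unknowns are the `n` weights, then the `k` left endpoints, then the `k` right endpoints.
    N : ℕ
    N = n ℕ.+ (k ℕ.+ k)

    iw : Fin n → Fin N
    iw u = u ↑ˡ (k ℕ.+ k)

    ia ib : Fin k → Fin N
    ia i = n ↑ʳ (i ↑ˡ k)
    ib i = n ↑ʳ (k ↑ʳ i)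

  IsWitness-semilinear : Semilinear {N} (λ ρ → IsWitness G (ρ ∘ iw) (ρ ∘ ia) (ρ ∘ ib))
  IsWitness-semilinear =
    ×-semilinear (∀-semilinear λ u → Rel-semilinear true (const 0ℚ) (var (iw u)) (eval-const 0ℚ) (eval-var (iw u)))
    (×-semilinear (∀-semilinear λ i → Rel-semilinear false (var (ia i)) (var (ib i)) (eval-var (ia i)) (eval-var (ib i)))
    (×-semilinear (∀-semilinear λ i → ∀-semilinear λ j → →-semilinear (toℕ j ℕ.≟ suc (toℕ i)) λ _ →
                     Rel-semilinear true (var (ib i)) (var (ia j)) (eval-var (ib i)) (eval-var (ia j)))
      (∀-semilinear λ u → ∀-semilinear λ v → →-semilinear (Dec.¬? (u ≟ v)) λ _ →
        ≡true-⇔-semilinear (Adj G u v)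
          (∃Fin-semilinear λ i → ×-semilinear
            (Rel-semilinear false (var (ia i)) (sum u v) (eval-var (ia i)) (eval-sum u v))
            (Rel-semilinear false (sum u v) (var (ib i)) (eval-sum u v) (eval-var (ib i))))
          -- Lying in no interval is rewritten without negation: for each interval, the sum is
          -- strictly below it or strictly above it.
          (resp-⇔ (λ ρ → mk⇔ outside⇒∉ ∉⇒outside)
            (∀-semilinear λ i → ⊎-semilinear
              (Rel-semilinear true (sum u v) (var (ia i)) (eval-sum u v) (eval-var (ia i)))
              (Rel-semilinear true (var (ib i)) (sum u v) (eval-var (ib i)) (eval-sum u v)))))))
    where
    sum : Fin n → Fin n → Affine N
    sum u v = var (iw u) ⊕ var (iw v)

    eval-sum : ∀ u v ρ → eval (sum u v) ρ ≡ ρ (iw u) + ρ (iw v)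
    eval-sum u v ρ = trans (eval-⊕ (var (iw u)) (var (iw v)) ρ) (cong₂ _+_ (eval-var (iw u) ρ) (eval-var (iw v) ρ))

    outside⇒∉ : ∀ {a b : Fin k → ℚ} {x} → (∀ i → x <ℚ a i ⊎ b i <ℚ x) → ¬ (∃[ i ] (a i ≤ℚ x × x ≤ℚ b i))
    outside⇒∉ out (i , a≤x , x≤b) with out i
    ... | inj₁ x<a = <⇒≱ x<a a≤x
    ... | inj₂ b<x = <⇒≱ b<x x≤b

    ∉⇒outside : ∀ {a b : Fin k → ℚ} {x} → ¬ (∃[ i ] (a i ≤ℚ x × x ≤ℚ b i)) → ∀ i → x <ℚ a i ⊎ b i <ℚ x
    ∉⇒outside {a} {b} {x} ∉ i with x ℚ.<? a i | b i ℚ.<? x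
    ... | yes x<a | _       = inj₁ x<a
    ... | no  _   | yes b<x = inj₂ b<x
    ... | no  x≮a | no  b≮x = ⊥-elim (∉ (i , ℚ.≮⇒≥ x≮a , ℚ.≮⇒≥ b≮x))

  witness? : Dec (Witness G k)
  witness? = Dec.map′
    (λ (ρ , pos , int , ord , edge) → record
      { w = ρ ∘ iw ; a = ρ ∘ ia ; b = ρ ∘ ib
      ; w-pos = pos ; interval = int ; ordered = ord ; edge-iff = edge })
    (λ W → env W , IsWitness-cong G (sym ∘ env-w W) (sym ∘ env-a W) (sym ∘ env-b W)
                     (w-pos W , interval W , ordered W , edge-iff W))
    (∃-env? IsWitness-semilinear)
    where
    env : Witness G k → Env N
    env W = [ w W , [ a W , b W ] ∘ splitAt k ] ∘ splitAt n

    env-w : ∀ W u → env W (iw u) ≡ w W u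
    env-w W u rewrite splitAt-↑ˡ n u (k ℕ.+ k) = refl

    env-a : ∀ W i → env W (ia i) ≡ a W i
    env-a W i rewrite splitAt-↑ʳ n (k ℕ.+ k) (i ↑ˡ k) | splitAt-↑ˡ k i k = refl

    env-b : ∀ W i → env W (ib i) ≡ b W i
    env-b W i rewrite splitAt-↑ʳ n (k ℕ.+ k) (k ↑ʳ i) | splitAt-↑ʳ k k i = refl

-- Search for the star number

witness⇒StarNumber≤ : ∀ {n k} {G : Graph n} → 1 ≤ k → Witness G k → StarNumber≤ G k
witness⇒StarNumber≤ {G = G} 1≤k W = [ id , (λ none → ⊥-elim (none _ 1≤k ℕ.≤-refl W)) ] (search _)
  where
  -- The search runs upwards, so the first witness found comes with a refutation of all smaller
  -- counts, which is its minimality. It cannot fail up to the given `k`, where `W` is a witness.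
  search : ∀ k → StarNumber≤ G k ⊎ (∀ j → 1 ≤ j → j ≤ k → ¬ Witness G j)
  search zero = inj₂ λ { _ () z≤n }
  search (suc k) = step (search k) (witness? G)
    where
    step : StarNumber≤ G k ⊎ (∀ j → 1 ≤ j → j ≤ k → ¬ Witness G j) → Dec (Witness G (suc k)) →
           StarNumber≤ G (suc k) ⊎ (∀ j → 1 ≤ j → j ≤ suc k → ¬ Witness G j)
    step (inj₁ (j , γ≡j , j≤k)) _ = inj₁ (j , γ≡j , ℕ.m≤n⇒m≤1+n j≤k)
    step (inj₂ none) (yes W) =
      inj₁ (suc k , (s≤s z≤n , W , λ j 1≤j j<1+k → none j 1≤j (ℕ.s≤s⁻¹ j<1+k)) , ℕ.≤-refl)
    step (inj₂ none) (no ¬W) = inj₂ λ j 1≤j j≤1+k W →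
      [ (λ j<1+k → none j 1≤j (ℕ.s≤s⁻¹ j<1+k) W) , (λ { refl → ¬W W }) ] (ℕ.m≤n⇒m<n∨m≡n j≤1+k)

-- The gaps between the intervals

-- Gap i is the open interval (gapˡ lo b i, gapʳ hi a i): its ends are
-- b_{i-1} and a_i, with lo and hi playing the roles of b_{-1} and a_k.
gapˡ : ∀ {k} → ℚ → (Fin k → ℚ) → Fin (suc k) → ℚ
gapˡ         lo b zero    = lo
gapˡ {suc k} lo b (suc i) = gapˡ (b zero) (b ∘ suc) i

gapʳ : ∀ {k} → ℚ → (Fin k → ℚ) → Fin (suc k) → ℚ
gapʳ {zero}  hi a zero    = hi
gapʳ {suc k} hi a zero    = a zero
gapʳ {suc k} hi a (suc i) = gapʳ hi (a ∘ suc) i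

-- Scan from the left: once `x` has passed the first interval, `b zero` takes over the role of `lo`
-- for the remaining ones.
interval-or-gap : ∀ {k} lo hi (a b : Fin k → ℚ) {x} → lo <ℚ x → x <ℚ hi →
                  (∃[ i ] (a i ≤ℚ x × x ≤ℚ b i)) ⊎ (∃[ i ] (gapˡ lo b i <ℚ x × x <ℚ gapʳ hi a i))
interval-or-gap {zero}  lo hi a b lo<x x<hi = inj₂ (zero , lo<x , x<hi)
interval-or-gap {suc k} lo hi a b {x} lo<x x<hi with x ℚ.<? a zero | b zero ℚ.<? x
... | yes x<a | _       = inj₂ (zero , lo<x , x<a)
... | no  x≮a | no  b≮x = inj₁ (zero , ℚ.≮⇒≥ x≮a , ℚ.≮⇒≥ b≮x)
... | no  _   | yes b<x = Sum.map (λ (i , h) → suc i , h) (λ (i , h) → suc i , h)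
                            (interval-or-gap (b zero) hi (a ∘ suc) (b ∘ suc) b<x x<hi)

gapˡ-lower : ∀ {k} lo (b : Fin k → ℚ) → (∀ i → lo ≤ℚ b i) → ∀ i → lo ≤ℚ gapˡ lo b i
gapˡ-lower         lo b lo≤b zero          = ℚ.≤-refl
gapˡ-lower {suc k} lo b lo≤b (suc zero)    = lo≤b zero
gapˡ-lower {suc (suc k)} lo b lo≤b (suc (suc i)) = gapˡ-lower lo (b ∘ suc) (lo≤b ∘ suc) (suc i)

gapˡ-last : ∀ {m} lo (b : Fin (suc m) → ℚ) → gapˡ lo b (fromℕ (suc m)) ≡ b (fromℕ m)
gapˡ-last {zero}  lo b = refl
gapˡ-last {suc m} lo b = gapˡ-last (b zero) (b ∘ suc)

record Intervals {k} (a b : Fin k → ℚ) : Set where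
  field
    a≤b : ∀ i → a i ≤ℚ b i
    b<a : ∀ i j → toℕ j ≡ suc (toℕ i) → b i <ℚ a j

open Intervals

tail : ∀ {k} {a b : Fin (suc k) → ℚ} → Intervals a b → Intervals (a ∘ suc) (b ∘ suc)
tail I = record { a≤b = a≤b I ∘ suc ; b<a = λ i j eq → b<a I (suc i) (suc j) (cong suc eq) }

-- Only consecutive intervals are compared by `Intervals`; the rest follows by chaining through the
-- intervals in between.
b₀<a : ∀ {k} {a b : Fin (suc k) → ℚ} → Intervals a b → ∀ i → b zero <ℚ a (suc i)
b₀<a {suc k} I zero = b<a I zero (suc zero) refl
b₀<a {suc k} I (suc i) =
  ℚ.<-trans (b<a I zero (suc zero) refl) (ℚ.≤-<-trans (a≤b I (suc zero)) (b₀<a (tail I) i))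

gap-disjoint : ∀ {k} lo hi {a b : Fin k → ℚ} → Intervals a b → ∀ {x} i j →
               gapˡ lo b i <ℚ x → x <ℚ gapʳ hi a i → a j ≤ℚ x → x ≤ℚ b j → ⊥
gap-disjoint {suc k} lo hi I zero zero _ x<a a≤x _ = <⇒≱ x<a a≤x
gap-disjoint {suc k} lo hi I zero (suc j) _ x<a a≤x _ =
  <⇒≱ (ℚ.<-trans x<a (ℚ.≤-<-trans (a≤b I zero) (b₀<a I j))) a≤x
gap-disjoint {suc k} lo hi {b = b} I (suc i) zero l<x _ _ x≤b =
  <⇒≱ l<x (ℚ.≤-trans x≤b (gapˡ-lower (b zero) (b ∘ suc) (λ j → ℚ.≤-trans (ℚ.<⇒≤ (b₀<a I j)) (a≤b I (suc j))) i))
gap-disjoint {suc k} lo hi I (suc i) (suc j) = gap-disjoint _ hi (tail I) i j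

gap-nonempty : ∀ {k} lo hi {a b : Fin k → ℚ} → Intervals a b → lo <ℚ hi →
               (∀ i → lo <ℚ a i) → (∀ i → b i <ℚ hi) → ∀ i → gapˡ lo b i <ℚ gapʳ hi a i
gap-nonempty {zero}  lo hi I lo<hi lo<a b<hi zero    = lo<hi
gap-nonempty {suc k} lo hi I lo<hi lo<a b<hi zero    = lo<a zero
gap-nonempty {suc k} lo hi I lo<hi lo<a b<hi (suc i) =
  gap-nonempty _ hi (tail I) (b<hi zero) (b₀<a I) (b<hi ∘ suc) i

-- Interval `i` separates gap `i` from the next one: the former ends at `a i` and the latter begins
-- at `b i`.
gap-adjacent : ∀ {k} lo hi {a b : Fin k → ℚ} → (∀ i → a i ≤ℚ b i) →
               ∀ i j → toℕ j ≡ suc (toℕ i) → gapʳ hi a i ≤ℚ gapˡ lo b j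
gap-adjacent {suc k} lo hi h zero    (suc zero) _  = h zero
gap-adjacent {suc k} lo hi h (suc i) (suc j)    eq = gap-adjacent _ hi (h ∘ suc) i j (ℕ.suc-injective eq)

-- Complements

complement-Adj : ∀ {n} (G : Graph n) {u v} → u ≢ v → Adj (complement G) u v ≡ not (Adj G u v)
complement-Adj G {u} {v} u≢v with u ≟ v
... | yes u≡v = ⊥-elim (u≢v u≡v)
... | no  _   = refl

complement-edge : ∀ {n} (G : Graph n) {u v} → u ≢ v → Adj (complement G) u v ≡ true → Adj G u v ≡ false
complement-edge G {u} {v} u≢v e with Adj G u v | trans (sym (complement-Adj G u≢v)) e
... | false | _ = refl

-- Serves to pass from the double complement, which has the same adjacencies, back to the graph
-- itself.
Witness-cong : ∀ {n k} {G H : Graph n} → (∀ u v → u ≢ v → Adj G u v ≡ Adj H u v) → Witness G k → Witness H k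
Witness-cong G≡H W = record
  { w = w W ; a = a W ; b = b W ; w-pos = w-pos W ; interval = interval W ; ordered = ordered W
  ; edge-iff = λ u v u≢v → subst (λ c → (c ≡ true) ⇔ _) (G≡H u v u≢v) (edge-iff W u v u≢v) }

module GapWitness {n k : ℕ} {G : Graph n} (W : Witness G k) where

  private
    sums : List ℚ
    sums = cartesianProductWith (λ u v → w W u + w W v) (allFin n) (allFin n)

    sum∈ : ∀ u v → w W u + w W v ∈ sums
    sum∈ u v = ∈-cartesianProductWith⁺ _ (∈-allFin u) (∈-allFin v)

    I : Intervals (a W) (b W)
    I = record { a≤b = interval W ; b<a = ordered W }

    -- Listing `0ℚ` here and in `high` forces `lo` below `hi`, even when there are neither intervals
    -- nor sums to separate them.
    low : ∃[ lo ] All (lo <ℚ_) (0ℚ ∷ tabulate (a W) ++ sums)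
    low = strictLowerBound _

    high : ∃[ hi ] All (_<ℚ hi) (0ℚ ∷ tabulate (b W) ++ sums)
    high = strictUpperBound _

  lo hi : ℚ
  lo = proj₁ low
  hi = proj₁ high

  private
    lo<a : ∀ i → lo <ℚ a W i
    lo<a = All.tabulate⁻ (All.++⁻ˡ _ (All.tail (proj₂ low)))

    b<hi : ∀ i → b W i <ℚ hi
    b<hi = All.tabulate⁻ (All.++⁻ˡ _ (All.tail (proj₂ high)))

    lo<sum : ∀ u v → lo <ℚ w W u + w W v
    lo<sum u v = All.lookup (All.++⁻ʳ (tabulate (a W)) (All.tail (proj₂ low))) (sum∈ u v)

    sum<hi : ∀ u v → w W u + w W v <ℚ hi
    sum<hi u v = All.lookup (All.++⁻ʳ (tabulate (b W)) (All.tail (proj₂ high))) (sum∈ u v)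

    shrunk : ∀ i → _
    shrunk i = shrink (gap-nonempty lo hi I (ℚ.<-trans (All.head (proj₂ low)) (All.head (proj₂ high))) lo<a b<hi i) sums

  gapA gapB : Fin (suc k) → ℚ
  gapA i = proj₁ (shrunk i)
  gapB i = proj₁ (proj₂ (shrunk i))

  gapˡ<gapA : ∀ i → gapˡ lo (b W) i <ℚ gapA i
  gapˡ<gapA i = proj₁ (proj₂ (proj₂ (shrunk i)))

  gapB<gapʳ : ∀ i → gapB i <ℚ gapʳ hi (a W) i
  gapB<gapʳ i = proj₁ (proj₂ (proj₂ (proj₂ (proj₂ (shrunk i)))))

  private
    gapA≤gapB : ∀ i → gapA i ≤ℚ gapB i
    gapA≤gapB i = proj₁ (proj₂ (proj₂ (proj₂ (shrunk i))))

    covered : ∀ i u v → gapˡ lo (b W) i <ℚ w W u + w W v → w W u + w W v <ℚ gapʳ hi (a W) i →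
              gapA i ≤ℚ w W u + w W v × w W u + w W v ≤ℚ gapB i
    covered i u v = All.lookup (proj₂ (proj₂ (proj₂ (proj₂ (proj₂ (shrunk i)))))) (sum∈ u v)

    nonedge-iff : ∀ u v → u ≢ v → (Adj (complement G) u v ≡ true) ⇔
                  (∃[ i ] (gapA i ≤ℚ w W u + w W v × w W u + w W v ≤ℚ gapB i))
    nonedge-iff u v u≢v = mk⇔ nonedge⇒gap gap⇒nonedge
      where
      nonedge⇒gap : Adj (complement G) u v ≡ true → _
      nonedge⇒gap ne with interval-or-gap lo hi (a W) (b W) (lo<sum u v) (sum<hi u v)
      ... | inj₂ (i , l , r) = i , covered i u v l r
      ... | inj₁ h with trans (sym (from (edge-iff W u v u≢v) h)) (complement-edge G u≢v ne)
      ...   | ()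

      gap⇒nonedge : _ → Adj (complement G) u v ≡ true
      -- Were `u` and `v` adjacent, their sum would lie both in an interval of `W` and in the open
      -- gap around the shrunk one.
      gap⇒nonedge (i , l , r) = trans (complement-Adj G u≢v) (cong not (¬-not λ e →
        let j , l′ , r′ = to (edge-iff W u v u≢v) e
        in gap-disjoint lo hi I i j (ℚ.<-≤-trans (gapˡ<gapA i) l) (ℚ.≤-<-trans r (gapB<gapʳ i)) l′ r′))

  gapWitness : Witness (complement G) (suc k)
  gapWitness = record
    { w = w W ; a = gapA ; b = gapB
    ; w-pos = w-pos W
    ; interval = gapA≤gapB
    ; ordered = λ i j eq → ℚ.<-trans (gapB<gapʳ i)
        (ℚ.≤-<-trans (gap-adjacent lo hi (interval W) i j eq) (gapˡ<gapA j))
    ; edge-iff = nonedge-iff }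

open GapWitness using (gapWitness)

-- Removing an end interval that contains no edge weight

EdgesAboveFirst : ∀ {n m} {G : Graph n} → Witness G (suc m) → Set
EdgesAboveFirst {G = G} W = ∀ u v → u ≢ v → Adj G u v ≡ true → b W zero <ℚ w W u + w W v

EdgesBelowLast : ∀ {n m} {G : Graph n} → Witness G (suc m) → Set
EdgesBelowLast {m = m} {G} W = ∀ u v → u ≢ v → Adj G u v ≡ true → w W u + w W v <ℚ a W (fromℕ m)

dropFirst : ∀ {n m} {G : Graph n} (W : Witness G (suc m)) → EdgesAboveFirst W → Witness G m
dropFirst {G = G} W above = record
  { w = w W ; a = a W ∘ suc ; b = b W ∘ suc
  ; w-pos = w-pos W
  ; interval = interval W ∘ suc
  ; ordered = λ i j eq → ordered W (suc i) (suc j) (cong suc eq)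
  ; edge-iff = λ u v u≢v → mk⇔
      (λ e → notFirst u v u≢v e (to (edge-iff W u v u≢v) e))
      (λ (i , h) → from (edge-iff W u v u≢v) (suc i , h)) }
  where
  notFirst : ∀ u v → u ≢ v → Adj G u v ≡ true → _ → _
  notFirst u v u≢v e (zero  , _ , x≤b) = ⊥-elim (<⇒≱ (above u v u≢v e) x≤b)
  notFirst u v u≢v e (suc i , h)       = i , h

dropLast : ∀ {n m} {G : Graph n} (W : Witness G (suc m)) → EdgesBelowLast W → Witness G m
dropLast {m = m} {G} W below = record
  { w = w W ; a = a W ∘ inject₁ ; b = b W ∘ inject₁
  ; w-pos = w-pos W
  ; interval = interval W ∘ inject₁
  ; ordered = λ i j eq → ordered W (inject₁ i) (inject₁ j)
      (trans (toℕ-inject₁ j) (trans eq (cong suc (sym (toℕ-inject₁ i)))))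
  ; edge-iff = λ u v u≢v → mk⇔
      -- `view` separates the last index, which `below` rules out, from those of the form
      -- `inject₁ j`, which survive.
      (λ e → let i , a≤x , x≤b = to (edge-iff W u v u≢v) e in notLast u v u≢v e i (view i) a≤x x≤b)
      (λ (i , h) → from (edge-iff W u v u≢v) (inject₁ i , h)) }
  where
  notLast : ∀ u v → u ≢ v → Adj G u v ≡ true → ∀ i → View i → a W i ≤ℚ w W u + w W v → w W u + w W v ≤ℚ b W i →
            ∃[ j ] (a W (inject₁ j) ≤ℚ w W u + w W v × w W u + w W v ≤ℚ b W (inject₁ j))
  notLast u v u≢v e _ ‵fromℕ       a≤x x≤b = ⊥-elim (<⇒≱ (below u v u≢v e) a≤x)
  notLast u v u≢v e _ (‵inject₁ j) a≤x x≤b = j , a≤x , x≤b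

module _ {n m : ℕ} {G : Graph n} (W : Witness G (suc m)) where

  open GapWitness W using (gapA; gapB<gapʳ; gapˡ<gapA; lo)

  -- The first gap ends before the first interval of `W` begins, while left-freeness puts all edges
  -- of the complement beyond that interval.
  leftFree⇒edgesAboveFirst : LeftFree W → EdgesAboveFirst (gapWitness W)
  leftFree⇒edgesAboveFirst left u v u≢v e =
    ℚ.<-trans (gapB<gapʳ zero) (ℚ.≤-<-trans (interval W zero) (left u v u≢v (complement-edge G u≢v e)))

  -- Symmetrically, the last gap begins beyond the last interval of `W`; `gapˡ-last` identifies its
  -- left end.
  rightFree⇒edgesBelowLast : RightFree W → EdgesBelowLast (gapWitness W)
  rightFree⇒edgesBelowLast right u v u≢v e =
    ℚ.<-trans (right u v u≢v (complement-edge G u≢v e))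
      (ℚ.≤-<-trans (interval W (fromℕ m))
        (subst (_<ℚ gapA (fromℕ (suc m))) (gapˡ-last lo (b W)) (gapˡ<gapA (fromℕ (suc m)))))

  free⇒complement-witness : Free W → Witness (complement G) (suc m)
  free⇒complement-witness (inj₁ left)  = dropFirst (gapWitness W) (leftFree⇒edgesAboveFirst left)
  free⇒complement-witness (inj₂ right) = dropLast (gapWitness W) (rightFree⇒edgesBelowLast right)

bothFree⇒complement-witness : ∀ {n m} {G : Graph n} (W : Witness G (suc m)) →
                              LeftFree W → RightFree W → Witness (complement G) m
bothFree⇒complement-witness W left right =
  -- Dropping the first interval shifts the indices but keeps the same last interval, so the bound
  -- from right-freeness still applies.
  dropLast (dropFirst (gapWitness W) (leftFree⇒edgesAboveFirst W left)) (rightFree⇒edgesBelowLast W right)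

complement-witness⇒witness : ∀ {n k} (G : Graph n) → Witness (complement G) k → Witness G (suc k)
complement-witness⇒witness G W = Witness-cong
  (λ u v u≢v → trans (complement-Adj (complement G) u≢v)
                     (trans (cong not (complement-Adj G u≢v)) (not-involutive _)))
  (gapWitness W)

theorem6 : ∀ {n} (G : Graph n) (m : ℕ) → StarNumber G (suc m) →
    (1 ≤ m → Σ (Witness G (suc m)) (λ W → LeftFree W × RightFree W) → StarNumber (complement G) m)
    × (¬ Σ (Witness G (suc m)) (λ W → LeftFree W × RightFree W) → Σ (Witness G (suc m)) Free
    → StarNumber≤ (complement G) (suc m))
    × (¬ Σ (Witness G (suc m)) Free → StarNumber≤ (complement G) (suc (suc m)))
theorem6 G m (_ , W , minimal) =
    (λ 1≤m (W , left , right) →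
       1≤m , bothFree⇒complement-witness W left right ,
       -- With `j` below `m`, a witness of the complement with `j` intervals would give one of `G`
       -- with `suc j`, fewer than its star number `suc m`.
       λ j _ j<m W′ → minimal (suc j) (s≤s z≤n) (s≤s j<m) (complement-witness⇒witness G W′))
  , (λ _ (W , W-free) → witness⇒StarNumber≤ (s≤s z≤n) (free⇒complement-witness W W-free))
  , (λ _ → witness⇒StarNumber≤ (s≤s z≤n) (gapWitness W))
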